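{- Let $n$ be an odd integer with $n\ge 931=\lceil 1861/2\rceil$ such that $D=n^2+1$ is squarefree. Then $h(D)>1$.
   Context: For a squarefree integer $D>1$, $h(D)$ denotes the class number of the real quadratic field $\mathbb{Q}(\sqrt D)$. -}

module Defs where

open import Data.Fin.Base using (Fin)
open import Data.Integer.Base as ℤ using (ℤ)
open import Data.Integer.Divisibility using (_∣_)
open import Data.List.Base using (List; []; _∷_)
open import Data.List.Relation.Unary.All using (All)
open import Data.Nat.Base using (ℕ)
open import Data.Product.Base using (∃; ∃₂; _×_; _,_)
open import Data.Rational.Base as ℚ using (ℚ; 0ℚ; 1ℚ)
open import Data.Rational.Solver using (module +-*-Solver)
open import Function.Bundles using (_⇔_; mk⇔; Bijection; module Equivalence)
open import Level using (0ℓ; suc)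
open import Relation.Binary.Bundles using (Setoid)
open import Relation.Binary.PropositionalEquality
  using (_≡_; _≢_; refl; sym; trans; cong; cong₂; subst; setoid)
open import Relation.Unary using (Pred; _∈_; _⊆_)

Odd : ℤ → Set
Odd n = ∃ λ k → n ≡ ℤ.+ 2 ℤ.* k ℤ.+ ℤ.+ 1

Squarefree : ℤ → Set
Squarefree D = ∀ d → d ℤ.* d ∣ D → ℤ.∣ d ∣ ≡ 1

-- The field ℚ(√ D); it is a quadratic field when D is not a square.
module QuadraticField (D : ℤ) where

  -- a +√D b  stands for  a + b√D
  infix 5 _+√D_
  record K : Set where
    constructor _+√D_
    field
      rat irr : ℚ
  open K public

  fromℚ : ℚ → K
  fromℚ q = q +√D 0ℚ

  fromℤ : ℤ → K
  fromℤ z = fromℚ (z ℚ./ 1)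

  0K 1K : K
  0K = fromℚ 0ℚ
  1K = fromℚ 1ℚ

  infixl 6 _+_
  infixl 7 _*_

  _+_ : K → K → K
  (a +√D b) + (c +√D d) = (a ℚ.+ c) +√D (b ℚ.+ d)

  _*_ : K → K → K
  (a +√D b) * (c +√D d) =
    (a ℚ.* c ℚ.+ D ℚ./ 1 ℚ.* (b ℚ.* d)) +√D (a ℚ.* d ℚ.+ b ℚ.* c)

  *-comm : ∀ x y → x * y ≡ y * x
  *-comm (a +√D b) (c +√D d) = cong₂ _+√D_
    (solve 5 (λ a b c d e → a :* c :+ e :* (b :* d) := c :* a :+ e :* (d :* b))
      refl a b c d (D ℚ./ 1))
    (solve 4 (λ a b c d → a :* d :+ b :* c := c :* b :+ d :* a) refl a b c d)
    where open +-*-Solver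

  *-assoc : ∀ x y z → (x * y) * z ≡ x * (y * z)
  *-assoc (a +√D b) (c +√D d) (p +√D q) = cong₂ _+√D_
    (solve 7 (λ a b c d p q e →
        (a :* c :+ e :* (b :* d)) :* p :+ e :* ((a :* d :+ b :* c) :* q)
        := a :* (c :* p :+ e :* (d :* q)) :+ e :* (b :* (c :* q :+ d :* p)))
      refl a b c d p q (D ℚ./ 1))
    (solve 7 (λ a b c d p q e →
        (a :* c :+ e :* (b :* d)) :* q :+ (a :* d :+ b :* c) :* p
        := a :* (c :* q :+ d :* p) :+ b :* (c :* p :+ e :* (d :* q)))
      refl a b c d p q (D ℚ./ 1))
    where open +-*-Solver

  *-identityˡ : ∀ x → 1K * x ≡ x
  *-identityˡ (a +√D b) = cong₂ _+√D_
    (solve 3 (λ a b e → con 1ℚ :* a :+ e :* (con 0ℚ :* b) := a)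
      refl a b (D ℚ./ 1))
    (solve 2 (λ a b → con 1ℚ :* b :+ con 0ℚ :* a := b) refl a b)
    where open +-*-Solver

  -- The value at x of the monic polynomial
  -- c₀ + c₁ X + ⋯ + cₙ₋₁ Xⁿ⁻¹ + Xⁿ, for the list c₀ ∷ c₁ ∷ ⋯ ∷ cₙ₋₁ ∷ [].
  evalMonic : List ℤ → K → K
  evalMonic []       x = 1K
  evalMonic (c ∷ cs) x = fromℤ c + x * evalMonic cs x

  -- The ring of integers.
  𝒪 : Pred K 0ℓ
  𝒪 x = ∃ λ cs → evalMonic cs x ≡ 0K

  -- The 𝒪-linear combinations of a list of elements.
  Span : List K → Pred K 0ℓ
  Span []       x = x ≡ 0K
  Span (g ∷ gs) x = ∃₂ λ c y → c ∈ 𝒪 × y ∈ Span gs × x ≡ c * g + y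

  -- Every ideal of 𝒪 is finitely generated, 𝒪 being Noetherian. Since this
  -- is not available constructively for an arbitrary predicate, an ideal
  -- comes with generators; ideal classes below do not depend on them.
  record NonzeroIdeal : Set₁ where
    field
      carrier    : Pred K 0ℓ
      integral   : carrier ⊆ 𝒪
      0-closed   : 0K ∈ carrier
      +-closed   : ∀ {x y} → x ∈ carrier → y ∈ carrier → x + y ∈ carrier
      *-closed   : ∀ {c x} → c ∈ 𝒪 → x ∈ carrier → c * x ∈ carrier
      nonzero    : ∃ λ x → x ∈ carrier × x ≢ 0K
      generators : List K
      generators-∈    : All carrier generators
      generators-span : carrier ⊆ Span generators

  open NonzeroIdeal using (carrier)

  _·_ : K → Pred K 0ℓ → Pred K 0ℓ
  (c · S) x = ∃ λ y → y ∈ S × x ≡ c * y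

  -- I and J lie in the same class when I = c J for some c ∈ K^×.
  infix 4 _∼_
  _∼_ : NonzeroIdeal → NonzeroIdeal → Set
  I ∼ J = ∃₂ λ c d → c * d ≡ 1K × (∀ x → x ∈ carrier I ⇔ x ∈ c · carrier J)

  private
    -- x = c y gives y = d x when c d = 1.
    cancel : ∀ {c d} → c * d ≡ 1K → ∀ y → d * (c * y) ≡ y
    cancel {c} {d} cd≡1 y =
      trans (sym (*-assoc d c y))
        (trans (cong (_* y) (trans (*-comm d c) cd≡1)) (*-identityˡ y))

  ∼-refl : ∀ {I} → I ∼ I
  ∼-refl {I} = 1K , 1K , *-identityˡ 1K , λ x → mk⇔
    (λ x∈I → x , x∈I , sym (*-identityˡ x))
    (λ { (y , y∈I , x≡y) →
         subst (carrier I) (sym (trans x≡y (*-identityˡ y))) y∈I })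

  ∼-sym : ∀ {I J} → I ∼ J → J ∼ I
  ∼-sym {I} {J} (c , d , cd≡1 , I⇔cJ) = d , c , dc≡1 , λ x → mk⇔
    (λ x∈J → c * x , Equivalence.from (I⇔cJ (c * x)) (x , x∈J , refl)
           , sym (cancel {c} {d} cd≡1 x))
    (λ { (y , y∈I , x≡dy) → let (z , z∈J , y≡cz) = Equivalence.to (I⇔cJ y) y∈I in
         subst (carrier J)
           (sym (trans x≡dy (trans (cong (d *_) y≡cz) (cancel {c} {d} cd≡1 z)))) z∈J })
    where
    dc≡1 : d * c ≡ 1K
    dc≡1 = trans (*-comm d c) cd≡1

  ∼-trans : ∀ {I J L} → I ∼ J → J ∼ L → I ∼ L
  ∼-trans {I} {J} {L} (c , d , cd≡1 , I⇔cJ) (c′ , d′ , cd′≡1 , J⇔c′L) =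
    c * c′ , d′ * d , unit , λ x → mk⇔
    (λ x∈I → let (y , y∈J , x≡cy)  = Equivalence.to (I⇔cJ x) x∈I
                 (z , z∈L , y≡c′z) = Equivalence.to (J⇔c′L y) y∈J
             in z , z∈L , trans x≡cy (trans (cong (c *_) y≡c′z) (sym (*-assoc c c′ z))))
    (λ { (z , z∈L , x≡cc′z) →
         Equivalence.from (I⇔cJ x)
           ( c′ * z , Equivalence.from (J⇔c′L (c′ * z)) (z , z∈L , refl)
           , trans x≡cc′z (*-assoc c c′ z)) })
    where
    unit : (c * c′) * (d′ * d) ≡ 1K
    unit = trans (*-assoc c c′ (d′ * d))
      (trans (cong (c *_) (trans (sym (*-assoc c′ d′ d))
               (trans (cong (_* d) cd′≡1) (*-identityˡ d)))) cd≡1)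

  -- The underlying set of the ideal class group.
  IdealClasses : Setoid (suc 0ℓ) 0ℓ
  IdealClasses = record
    { Carrier       = NonzeroIdeal
    ; _≈_           = _∼_
    ; isEquivalence = record
      { refl  = λ {I} → ∼-refl {I}
      ; sym   = λ {I} {J} → ∼-sym {I} {J}
      ; trans = λ {I} {J} {L} → ∼-trans {I} {J} {L}
      }
    }

-- h(D) = h: the ideal class group of ℚ(√ D) has exactly h elements.
IsClassNumber : ℤ → ℕ → Set₁
IsClassNumber D h =
  Bijection (setoid (Fin h)) (QuadraticField.IdealClasses D)

{-# OPTIONS --safe #-}

-- Write D = n² + 1 with n odd, so D ≡ 2 (mod 4) and the ring of integers is ℤ[√D]. A generator
-- of the prime (2, √D) above 2 would have norm ±2. But x² − D y² = ±2 has no solution for n ≥ 2: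
-- multiplying by the unit n − √D of norm −1 turns a solution into one with smaller ∣y∣, and y = 0
-- is impossible because 2 is not a square. So (2, √D) is not principal.
--
-- To see that an integral x lies in ℤ[√D], note that the powers of x have a common denominator.
-- Taking norms, so do the powers of N(x), whence N(x) ∈ ℤ; likewise N(1 + x) ∈ ℤ, and so the trace
-- of x is an integer. Squarefreeness of D and a computation modulo 4 do the rest.
module Submission where

open import Defs using (Odd; Squarefree; IsClassNumber; module QuadraticField)
open import Algebra.Bundles using (CommutativeSemiring)
import Algebra.Solver.Ring.NaturalCoefficients.Default as SemiringSolver
open import Data.Empty using (⊥; ⊥-elim)
open import Data.Fin.Base using (zero)
open import Data.Integer.Base as ℤ using (ℤ; +_; 0ℤ; 1ℤ)
import Data.Integer.DivMod as ℤ
import Data.Integer.Properties as ℤ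
open import Data.Integer.Solver using () renaming (module +-*-Solver to ℤ-Solver)
open import Data.List.Base using (List; []; _∷_; map; tails)
import Data.List.Relation.Unary.All as All
open import Data.List.Relation.Unary.All.Properties using (map⁻)
open import Data.Nat.Base as ℕ using (ℕ; zero; suc)
open import Data.Nat.Coprimality as Coprimality using (Coprime)
import Data.Nat.Divisibility as ℕ
open import Data.Nat.Induction using (<-rec)
import Data.Nat.Properties as ℕ
open import Data.Product.Base using (∃; ∃₂; _×_; _,_; proj₁; proj₂)
open import Data.Rational.Base as ℚ using (ℚ; 0ℚ; 1ℚ; mkℚ; ↥_; ↧_; ↧ₙ_)
import Data.Rational.Properties as ℚ
open import Data.Rational.Solver using () renaming (module +-*-Solver to ℚ-Solver)
open import Data.Rational.Unnormalised.Base as ℚᵘ using (mkℚᵘ)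
import Data.Rational.Unnormalised.Properties as ℚᵘ
open import Data.Sum.Base using (_⊎_; inj₁; inj₂)
open import Function.Bundles using (Equivalence; module Bijection)
open import Level using (0ℓ)
open import Relation.Binary.PropositionalEquality
open import Relation.Nullary.Negation using (¬_)

-- The equation a² − (n² + 1) b² = ±2

module Descent where
  open import Data.Nat.Base using (_+_; _*_; _∸_; _≤_; _<_; z≤n; s≤s; NonZero)
  open import Data.Nat.Properties
  open import Data.Nat.Tactic.RingSolver using (solve; solve-∀)

  Norm±2 : ℕ → ℕ → ℕ → Set
  Norm±2 n a b =
    a * a ≡ (n * n + 1) * (b * b) + 2 ⊎ a * a + 2 ≡ (n * n + 1) * (b * b)

  square≢2 : ∀ a → a * a ≢ 2
  square≢2 zero ()
  square≢2 (suc zero) ()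
  square≢2 a@(suc (suc _)) eq = <-irrefl (sym eq)
    (<-≤-trans (s≤s (s≤s (s≤s z≤n))) (*-mono-≤ {2} {a} {2} {a} (s≤s (s≤s z≤n)) (s≤s (s≤s z≤n))))

  2<2nbb : ∀ n b → .{{NonZero b}} → 2 ≤ n → 2 < 2 * n * (b * b)
  2<2nbb n b@(suc _) 2≤n = ≤-trans (s≤s (s≤s (s≤s z≤n)))
    (*-mono-≤ (*-monoʳ-≤ 2 2≤n) (*-mono-≤ {1} {b} {1} {b} (s≤s z≤n) (s≤s z≤n)))

  -- Since (nb + b)² = (n² + 1)b² + 2nb² and 2nb² > 2, the square of nb + b exceeds a² for either
  -- sign of the norm. With `nb≤a` this confines a - nb to the range from 0 to b - 1.
  a<nb+b : ∀ n a b → .{{NonZero b}} → 2 ≤ n → Norm±2 n a b → a < n * b + b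
  a<nb+b n a b 2≤n eq = ≰⇒> λ nb+b≤a → <⇒≱ (upper eq) (*-mono-≤ nb+b≤a nb+b≤a)
    where
    open ≤-Reasoning
    big : (n * n + 1) * (b * b) + 2 < (n * b + b) * (n * b + b)
    big = begin-strict
      (n * n + 1) * (b * b) + 2                 <⟨ +-monoʳ-< _ (2<2nbb n b 2≤n) ⟩
      (n * n + 1) * (b * b) + 2 * n * (b * b)   ≡⟨ solve (n ∷ b ∷ []) ⟩
      (n * b + b) * (n * b + b)                 ∎
    upper : Norm±2 n a b → a * a < (n * b + b) * (n * b + b)
    upper (inj₁ e) = ≤-<-trans (≤-reflexive e) big
    upper (inj₂ e) = ≤-<-trans (≤-trans (m≤m+n _ 2) (≤-trans (≤-reflexive e) (m≤m+n _ 2))) big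

  -- If a < nb, norm 2 fails at once because a² < n²b². For norm -2, the stronger (a + 1)² ≤ n²b²
  -- gives (a + 1)² + 1 ≤ (n² + 1)b² = a² + 2, which is false for a ≥ 1.
  nb≤a : ∀ n a b → .{{NonZero b}} → 2 ≤ n → Norm±2 n a b → n * b ≤ a
  nb≤a n a b@(suc _) 2≤n eq = ≮⇒≥ λ a<nb → lower a<nb eq
    where
    open ≤-Reasoning
    1≤bb : 1 ≤ b * b
    1≤bb = s≤s z≤n
    lower : a < n * b → Norm±2 n a b → ⊥
    lower a<nb (inj₁ e) = <-irrefl refl (begin-strict
      a * a                       <⟨ *-mono-< a<nb a<nb ⟩
      (n * b) * (n * b)           ≤⟨ m≤m+n _ _ ⟩
      (n * b) * (n * b) + (b * b + 2) ≡⟨ lem n b ⟩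
      (n * n + 1) * (b * b) + 2   ≡⟨ e ⟨
      a * a                       ∎)
      where
      lem : ∀ n b → (n * b) * (n * b) + (b * b + 2) ≡ (n * n + 1) * (b * b) + 2
      lem = solve-∀
    lower a<nb (inj₂ e) = small a e (begin
      suc a * suc a + 1               ≤⟨ +-mono-≤ (*-mono-≤ a<nb a<nb) 1≤bb ⟩
      (n * b) * (n * b) + b * b       ≡⟨ lem n b ⟩
      (n * n + 1) * (b * b)           ∎)
      where
      lem : ∀ n b → (n * b) * (n * b) + b * b ≡ (n * n + 1) * (b * b)
      lem = solve-∀
      small : ∀ a → a * a + 2 ≡ (n * n + 1) * (b * b) → suc a * suc a + 1 ≤ (n * n + 1) * (b * b) → ⊥
      -- For a = 0 the comparison of squares only says 2 ≤ 2. Here the contradiction is (n² + 1)b² ≥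
      -- 5, from n ≥ 2 and b ≥ 1.
      small zero e _ = <⇒≱
        (<-≤-trans (s≤s (s≤s (s≤s z≤n)))
          (*-mono-≤ {5} {n * n + 1} {1} (+-monoˡ-≤ 1 (*-mono-≤ 2≤n 2≤n)) 1≤bb))
        (≤-reflexive (sym e))
      small (suc a) e le = <⇒≱ (begin-strict
        suc a * suc a + 2                              <⟨ m<m+n _ (s≤s z≤n) ⟩
        suc a * suc a + 2 + suc (2 * a + 1)            ≡⟨ solve (a ∷ []) ⟩
        suc (suc a) * suc (suc a) + 1                  ≤⟨ le ⟩
        (n * n + 1) * (b * b)                          ∎) (≤-reflexive (sym e))

  -- The witness is the distance between b and m. Moving the cross term to the left expresses (b -
  -- m)² without subtraction; the sign of b - m is lost, but the norm equation sees only squares.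
  square-of-difference : ∀ b m → ∃ λ s → s * s + 2 * (b * m) ≡ b * b + m * m
  square-of-difference b m with ≤-total b m
  ... | inj₁ b≤m = m ∸ b , lem (m ∸ b) (sym (m+[n∸m]≡n b≤m))
    where
    lem : ∀ s → m ≡ b + s → s * s + 2 * (b * m) ≡ b * b + m * m
    lem s refl = solve (b ∷ s ∷ [])
  ... | inj₂ m≤b = b ∸ m , lem (b ∸ m) (sym (m+[n∸m]≡n m≤b))
    where
    lem : ∀ s → b ≡ m + s → s * s + 2 * (b * m) ≡ b * b + m * m
    lem s refl = solve (m ∷ s ∷ [])

  swap : ∀ x y z → x + y + z ≡ x + z + y
  swap = solve-∀

  collect : ∀ n b r → 2 * (b * (n * r)) + r * r + (n * r) * (n * r) ≡
    (n * n + 1) * (r * r) + 2 * (b * (n * r))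
  collect = solve-∀

  -- Multiplication by the unit n − √D of norm −1 sends (nb + r) + b√D to (b − nr) + r√D up to sign.
  descend : ∀ n b r → Norm±2 n (n * b + r) b → ∃ λ s → Norm±2 n s r
  descend n b r e with s , es ← square-of-difference b (n * r) = s , flip e
    where
    open ≡-Reasoning
    expand : (n * b + r) * (n * b + r) ≡ n * n * (b * b) + (2 * (b * (n * r)) + r * r)
    expand = solve (n ∷ b ∷ r ∷ [])
    flip : Norm±2 n (n * b + r) b → Norm±2 n s r
    flip (inj₁ e) = inj₂ (+-cancelʳ-≡ (2 * (b * (n * r))) _ _ (begin
      s * s + 2 + 2 * (b * (n * r))               ≡⟨ swap (s * s) 2 (2 * (b * (n * r))) ⟩
      s * s + 2 * (b * (n * r)) + 2               ≡⟨ cong (_+ 2) es ⟩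
      b * b + (n * r) * (n * r) + 2               ≡⟨ swap (b * b) ((n * r) * (n * r)) 2 ⟩
      b * b + 2 + (n * r) * (n * r)               ≡⟨ cong (_+ (n * r) * (n * r)) reduced ⟨
      2 * (b * (n * r)) + r * r + (n * r) * (n * r) ≡⟨ collect n b r ⟩
      (n * n + 1) * (r * r) + 2 * (b * (n * r))   ∎))
      where
      reduced : 2 * (b * (n * r)) + r * r ≡ b * b + 2
      reduced = +-cancelˡ-≡ (n * n * (b * b)) _ _ (trans (sym expand) (trans e (solve (n ∷ b ∷ []))))
    flip (inj₂ e) = inj₁ (+-cancelʳ-≡ (2 * (b * (n * r))) _ _ (begin
      s * s + 2 * (b * (n * r))                   ≡⟨ es ⟩
      b * b + (n * r) * (n * r)                   ≡⟨ cong (_+ (n * r) * (n * r)) reduced ⟨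
      2 * (b * (n * r)) + r * r + 2 + (n * r) * (n * r) ≡⟨ swap (2 * (b * (n * r)) + r * r) 2 _ ⟩
      2 * (b * (n * r)) + r * r + (n * r) * (n * r) + 2 ≡⟨ cong (_+ 2) (collect n b r) ⟩
      (n * n + 1) * (r * r) + 2 * (b * (n * r)) + 2
        ≡⟨ swap ((n * n + 1) * (r * r)) (2 * (b * (n * r))) 2 ⟩
      (n * n + 1) * (r * r) + 2 + 2 * (b * (n * r))   ∎))
      where
      reduced : 2 * (b * (n * r)) + r * r + 2 ≡ b * b
      reduced = +-cancelˡ-≡ (n * n * (b * b)) _ _
        (trans (sym (+-assoc (n * n * (b * b)) _ 2))
          (trans (cong (_+ 2) (sym expand)) (trans e (solve (n ∷ b ∷ [])))))

  no-Norm±2 : ∀ n → 2 ≤ n → ∀ b a → ¬ Norm±2 n a b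
  no-Norm±2 n 2≤n = <-rec _ step
    where
    step : ∀ b → (∀ {r} → r < b → ∀ a → ¬ Norm±2 n a r) → ∀ a → ¬ Norm±2 n a b
    step zero rec a (inj₁ e) = square≢2 a (trans e (cong (_+ 2) (*-zeroʳ (n * n + 1))))
    step zero rec a (inj₂ e) = case (trans (+-comm 2 (a * a)) (trans e (*-zeroʳ (n * n + 1))))
      where
      case : ∀ {m} → 2 + m ≢ 0
      case ()
    step b@(suc _) rec a e =
      let s , e′ = descend n b r (subst (λ a → Norm±2 n a b) a≡nb+r e) in rec r<b s e′
      where
      -- The two bounds on a make this truncated subtraction exact and put r below b, so the descent
      -- applies to r.
      r = a ∸ n * b
      a≡nb+r : a ≡ n * b + r
      a≡nb+r = sym (m+[n∸m]≡n (nb≤a n a b 2≤n e))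
      r<b : r < b
      r<b = +-cancelˡ-< (n * b) r b (subst (_< n * b + b) a≡nb+r (a<nb+b n a b 2≤n e))

open Descent using (Norm±2; no-Norm±2)

-- Rational numbers that are integers

ι : ℤ → ℚ
ι z = z ℚ./ 1

-- `ι z` is a normalised fraction. Passing to the unnormalised z/1 turns the homomorphism laws of
-- `ι` into cross-multiplications of integers.
toℚᵘ-ι : ∀ z → ℚ.toℚᵘ (ι z) ℚᵘ.≃ mkℚᵘ z 0
toℚᵘ-ι z = ℚ.toℚᵘ-fromℚᵘ (mkℚᵘ z 0)

ι-injective : ∀ y z → ι y ≡ ι z → y ≡ z
ι-injective y z eq
  with ℚᵘ.*≡* e ← ℚᵘ.≃-trans (ℚᵘ.≃-sym (toℚᵘ-ι y)) (ℚᵘ.≃-trans (ℚ.toℚᵘ-cong eq) (toℚᵘ-ι z)) =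
  trans (sym (ℤ.*-identityʳ y)) (trans e (ℤ.*-identityʳ z))

ι-+ : ∀ y z → ι (y ℤ.+ z) ≡ ι y ℚ.+ ι z
ι-+ y z = ℚ.toℚᵘ-injective (begin-equality
  ℚ.toℚᵘ (ι (y ℤ.+ z))             ≃⟨ toℚᵘ-ι (y ℤ.+ z) ⟩
  mkℚᵘ (y ℤ.+ z) 0
    ≃⟨ ℚᵘ.*≡* (cong (ℤ._* 1ℤ) (sym (cong₂ ℤ._+_ (ℤ.*-identityʳ y) (ℤ.*-identityʳ z)))) ⟩
  mkℚᵘ y 0 ℚᵘ.+ mkℚᵘ z 0           ≃⟨ ℚᵘ.+-cong (toℚᵘ-ι y) (toℚᵘ-ι z) ⟨
  ℚ.toℚᵘ (ι y) ℚᵘ.+ ℚ.toℚᵘ (ι z)   ≃⟨ ℚ.toℚᵘ-homo-+ (ι y) (ι z) ⟨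
  ℚ.toℚᵘ (ι y ℚ.+ ι z)             ∎)
  where open ℚᵘ.≤-Reasoning

ι-* : ∀ y z → ι (y ℤ.* z) ≡ ι y ℚ.* ι z
ι-* y z = ℚ.toℚᵘ-injective (begin-equality
  ℚ.toℚᵘ (ι (y ℤ.* z))             ≃⟨ toℚᵘ-ι (y ℤ.* z) ⟩
  mkℚᵘ (y ℤ.* z) 0                 ≡⟨⟩
  mkℚᵘ y 0 ℚᵘ.* mkℚᵘ z 0           ≃⟨ ℚᵘ.*-cong (toℚᵘ-ι y) (toℚᵘ-ι z) ⟨
  ℚ.toℚᵘ (ι y) ℚᵘ.* ℚ.toℚᵘ (ι z)   ≃⟨ ℚ.toℚᵘ-homo-* (ι y) (ι z) ⟨
  ℚ.toℚᵘ (ι y ℚ.* ι z)             ∎)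
  where open ℚᵘ.≤-Reasoning

ι-neg : ∀ z → ι (ℤ.- z) ≡ ℚ.- ι z
ι-neg z = ℚ.toℚᵘ-injective (begin-equality
  ℚ.toℚᵘ (ι (ℤ.- z))         ≃⟨ toℚᵘ-ι (ℤ.- z) ⟩
  ℚᵘ.- mkℚᵘ z 0              ≃⟨ ℚᵘ.-‿cong (toℚᵘ-ι z) ⟨
  ℚᵘ.- ℚ.toℚᵘ (ι z)          ≃⟨ ℚ.toℚᵘ-homo‿- (ι z) ⟨
  ℚ.toℚᵘ (ℚ.- ι z)           ∎)
  where open ℚᵘ.≤-Reasoning

q*↧q≡↥q : ∀ q → q ℚ.* ι (↧ q) ≡ ι (↥ q)
q*↧q≡↥q q = ℚ.toℚᵘ-injective (begin-equality
  ℚ.toℚᵘ (q ℚ.* ι (↧ q))                ≃⟨ ℚ.toℚᵘ-homo-* q (ι (↧ q)) ⟩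
  ℚ.toℚᵘ q ℚᵘ.* ℚ.toℚᵘ (ι (↧ q))        ≃⟨ ℚᵘ.*-congˡ {ℚ.toℚᵘ q} (toℚᵘ-ι (↧ q)) ⟩
  ℚ.toℚᵘ q ℚᵘ.* mkℚᵘ (↧ q) 0            ≃⟨ cancel q ⟩
  mkℚᵘ (↥ q) 0                          ≃⟨ toℚᵘ-ι (↥ q) ⟨
  ℚ.toℚᵘ (ι (↥ q))                      ∎)
  where
  open ℚᵘ.≤-Reasoning
  cancel : ∀ q → ℚ.toℚᵘ q ℚᵘ.* mkℚᵘ (↧ q) 0 ℚᵘ.≃ mkℚᵘ (↥ q) 0
  cancel (mkℚ n d-1 _) = ℚᵘ.*≡*
    (trans (ℤ.*-identityʳ _) (cong (λ d → n ℤ.* + d) (sym (ℕ.*-identityʳ (suc d-1)))))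

IsInteger : ℚ → Set
IsInteger q = ∃ λ z → q ≡ ι z

↧≡1⇒integer : ∀ q → ↧ₙ q ≡ 1 → IsInteger q
↧≡1⇒integer q eq = ↥ q , (begin
  q                  ≡⟨ ℚ.*-identityʳ q ⟨
  q ℚ.* ι (+ 1)      ≡⟨ cong (λ d → q ℚ.* ι (+ d)) eq ⟨
  q ℚ.* ι (↧ q)      ≡⟨ q*↧q≡↥q q ⟩
  ι (↥ q)            ∎)
  where open ≡-Reasoning

-- Bounding denominators by coprimality

coprime-↧-↥ : ∀ q → Coprime (↧ₙ q) ℤ.∣ ↥ q ∣
coprime-↧-↥ (mkℚ n d-1 c) = Coprimality.sym (Coprimality.recompute c)

-- The sequence t has constant ratio u/w in lowest terms, so w divides every term. The quotients by
-- w again have ratio u/w, and induction on m removes one factor w at a time.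
powers-divide : ∀ {w u} .{{_ : ℕ.NonZero w}} → Coprime w u → ∀ m (t : ℕ → ℕ) →
                (∀ k → t (suc k) ℕ.* w ≡ t k ℕ.* u) → w ℕ.^ m ℕ.∣ t 0
powers-divide c zero t rec = ℕ.1∣ t 0
powers-divide {w} {u} c (suc m) t rec =
  subst (w ℕ.* w ℕ.^ m ℕ.∣_) (sym (ℕ.m∣n⇒n≡m*quotient (w∣t 0)))
    (ℕ.*-monoʳ-∣ w (powers-divide c m t′ rec′))
  where
  w∣t : ∀ k → w ℕ.∣ t k
  w∣t k = Coprimality.coprime-divisor c
    (subst (w ℕ.∣_) (trans (rec k) (ℕ.*-comm (t k) u)) (ℕ.n∣m*n (t (suc k))))
  t′ : ℕ → ℕ
  t′ k = ℕ.quotient (w∣t k)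
  open ≡-Reasoning
  rec′ : ∀ k → t′ (suc k) ℕ.* w ≡ t′ k ℕ.* u
  rec′ k = ℕ.*-cancelʳ-≡ _ _ w (begin
    t′ (suc k) ℕ.* w ℕ.* w  ≡⟨ cong (ℕ._* w) (ℕ.m∣n⇒n≡quotient*m (w∣t (suc k))) ⟨
    t (suc k) ℕ.* w         ≡⟨ rec k ⟩
    t k ℕ.* u               ≡⟨ cong (ℕ._* u) (ℕ.m∣n⇒n≡quotient*m (w∣t k)) ⟩
    t′ k ℕ.* w ℕ.* u        ≡⟨ ℕ.*-assoc (t′ k) w u ⟩
    t′ k ℕ.* (w ℕ.* u)      ≡⟨ cong (t′ k ℕ.*_) (ℕ.*-comm w u) ⟩
    t′ k ℕ.* (u ℕ.* w)      ≡⟨ ℕ.*-assoc (t′ k) u w ⟨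
    t′ k ℕ.* u ℕ.* w        ∎)

n<m^n : ∀ m n → 1 ℕ.< m → n ℕ.< m ℕ.^ n
n<m^n m zero 1<m = ℕ.s≤s ℕ.z≤n
n<m^n m (suc n) 1<m = ℕ.≤-<-trans (n<m^n m n 1<m) (ℕ.^-monoʳ-< m 1<m (ℕ.n<1+n n))

all-powers-divide⇒≡1 : ∀ w n .{{_ : ℕ.NonZero w}} .{{_ : ℕ.NonZero n}} → (∀ m → w ℕ.^ m ℕ.∣ n) → w ≡ 1
all-powers-divide⇒≡1 (suc zero) n _ = refl
all-powers-divide⇒≡1 w@(suc (suc _)) n div =
  -- The exponent n is already large enough: for w ≥ 2, wⁿ > n cannot divide n.
  ⊥-elim (ℕ.<⇒≱ (n<m^n w n (ℕ.s≤s (ℕ.s≤s ℕ.z≤n))) (ℕ.∣⇒≤ (div n)))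

-- The terms are t₀qᵏ. If all of them are integers, every power of the denominator of q divides the
-- nonzero t₀, so the denominator is 1.
integral-ratio : ∀ q (t : ℕ → ℤ) → t 0 ≢ 0ℤ → (∀ k → ι (t (suc k)) ≡ q ℚ.* ι (t k)) → IsInteger q
integral-ratio q t t₀≢0 rec = ↧≡1⇒integer q
  (all-powers-divide⇒≡1 (↧ₙ q) ℤ.∣ t 0 ∣ {{_}} {{ℕ.≢-nonZero λ e → t₀≢0 (ℤ.∣i∣≡0⇒i≡0 e)}}
    λ m → powers-divide (coprime-↧-↥ q) m (λ k → ℤ.∣ t k ∣) λ k → begin
      ℤ.∣ t (suc k) ∣ ℕ.* ↧ₙ q           ≡⟨ ℤ.abs-* (t (suc k)) (↧ q) ⟨
      ℤ.∣ t (suc k) ℤ.* ↧ q ∣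
        ≡⟨ cong ℤ.∣_∣ (ι-injective (t (suc k) ℤ.* ↧ q) (t k ℤ.* ↥ q) (recℚ k)) ⟩
      ℤ.∣ t k ℤ.* ↥ q ∣                  ≡⟨ ℤ.abs-* (t k) (↥ q) ⟩
      ℤ.∣ t k ∣ ℕ.* ℤ.∣ ↥ q ∣            ∎)
  where
  open ≡-Reasoning
  recℚ : ∀ k → ι (t (suc k) ℤ.* ↧ q) ≡ ι (t k ℤ.* ↥ q)
  recℚ k = begin
    ι (t (suc k) ℤ.* ↧ q)         ≡⟨ ι-* (t (suc k)) (↧ q) ⟩
    ι (t (suc k)) ℚ.* ι (↧ q)     ≡⟨ cong (ℚ._* ι (↧ q)) (rec k) ⟩
    q ℚ.* ι (t k) ℚ.* ι (↧ q)
      ≡⟨ solve 3 (λ q t w → q :* t :* w := t :* (q :* w)) refl q (ι (t k)) (ι (↧ q)) ⟩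
    ι (t k) ℚ.* (q ℚ.* ι (↧ q))   ≡⟨ cong (ι (t k) ℚ.*_) (q*↧q≡↥q q) ⟩
    ι (t k) ℚ.* ι (↥ q)           ≡⟨ ι-* (t k) (↥ q) ⟨
    ι (t k ℤ.* ↥ q)               ∎
    where open ℚ-Solver

coprime-square-divisor : ∀ {w u} x → Coprime w u → w ℕ.∣ x ℕ.* (u ℕ.* u) → w ℕ.∣ x
coprime-square-divisor {w} {u} x c w∣xuu =
  Coprimality.coprime-divisor c (Coprimality.coprime-divisor c
    (subst (w ℕ.∣_) (trans (ℕ.*-comm x _) (ℕ.*-assoc u u x)) w∣xuu))

-- The factor w is removed twice: first w divides x, say x = yw; cancelling w leaves w dividing yu²,
-- so w divides y as well.
coprime-square-divides : ∀ {w u} x .{{_ : ℕ.NonZero w}} → Coprime w u →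
                         w ℕ.* w ℕ.∣ x ℕ.* (u ℕ.* u) → w ℕ.* w ℕ.∣ x
coprime-square-divides {w} {u} x c ww∣xuu
  with ℕ.divides-refl y ← coprime-square-divisor x c (ℕ.m*n∣⇒m∣ w w ww∣xuu) =
  ℕ.*-monoˡ-∣ w (coprime-square-divisor y c
    (ℕ.*-cancelˡ-∣ w (subst (w ℕ.* w ℕ.∣_)
      (trans (cong (ℕ._* (u ℕ.* u)) (ℕ.*-comm y w)) (ℕ.*-assoc w y (u ℕ.* u))) ww∣xuu)))

-- With q = u/w in lowest terms, Du² = Mw² shows that w² divides D. Squarefreeness then forces w =
-- 1.
squarefree-*-square : ∀ {D} → Squarefree D → ∀ q → IsInteger (ι D ℚ.* (q ℚ.* q)) → IsInteger q
squarefree-*-square {D} sf q (M , eq) = ↧≡1⇒integer q (sf (↧ q)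
  (subst (ℕ._∣ ℤ.∣ D ∣) (sym (ℤ.abs-* (↧ q) (↧ q)))
  (coprime-square-divides ℤ.∣ D ∣ (coprime-↧-↥ q)
    (ℕ.divides ℤ.∣ M ∣ (begin
      ℤ.∣ D ∣ ℕ.* (ℤ.∣ ↥ q ∣ ℕ.* ℤ.∣ ↥ q ∣)  ≡⟨ cong (ℤ.∣ D ∣ ℕ.*_) (ℤ.abs-* (↥ q) (↥ q)) ⟨
      ℤ.∣ D ∣ ℕ.* ℤ.∣ ↥ q ℤ.* ↥ q ∣          ≡⟨ ℤ.abs-* D (↥ q ℤ.* ↥ q) ⟨
      ℤ.∣ D ℤ.* (↥ q ℤ.* ↥ q) ∣
        ≡⟨ cong ℤ.∣_∣ (ι-injective (D ℤ.* (↥ q ℤ.* ↥ q)) (M ℤ.* (↧ q ℤ.* ↧ q)) clear) ⟩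
      ℤ.∣ M ℤ.* (↧ q ℤ.* ↧ q) ∣              ≡⟨ ℤ.abs-* M (↧ q ℤ.* ↧ q) ⟩
      ℤ.∣ M ∣ ℕ.* ℤ.∣ ↧ q ℤ.* ↧ q ∣          ≡⟨ cong (ℤ.∣ M ∣ ℕ.*_) (ℤ.abs-* (↧ q) (↧ q)) ⟩
      ℤ.∣ M ∣ ℕ.* (↧ₙ q ℕ.* ↧ₙ q)            ∎)))))
  where
  open ≡-Reasoning
  ι-*-square : ∀ x y → ι (x ℤ.* (y ℤ.* y)) ≡ ι x ℚ.* (ι y ℚ.* ι y)
  ι-*-square x y = trans (ι-* x (y ℤ.* y)) (cong (ι x ℚ.*_) (ι-* y y))
  clear : ι (D ℤ.* (↥ q ℤ.* ↥ q)) ≡ ι (M ℤ.* (↧ q ℤ.* ↧ q))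
  clear = begin
    ι (D ℤ.* (↥ q ℤ.* ↥ q))                                ≡⟨ ι-*-square D (↥ q) ⟩
    ι D ℚ.* (ι (↥ q) ℚ.* ι (↥ q))
      ≡⟨ cong (λ u → ι D ℚ.* (u ℚ.* u)) (q*↧q≡↥q q) ⟨
    ι D ℚ.* (q ℚ.* ι (↧ q) ℚ.* (q ℚ.* ι (↧ q)))
      ≡⟨ solve 3 (λ d q w → d :* (q :* w :* (q :* w))
           := d :* (q :* q) :* (w :* w)) refl (ι D) q (ι (↧ q)) ⟩
    ι D ℚ.* (q ℚ.* q) ℚ.* (ι (↧ q) ℚ.* ι (↧ q))            ≡⟨ cong (ℚ._* (ι (↧ q) ℚ.* ι (↧ q))) eq ⟩
    ι M ℚ.* (ι (↧ q) ℚ.* ι (↧ q))                          ≡⟨ ι-*-square M (↧ q) ⟨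
    ι (M ℤ.* (↧ q ℤ.* ↧ q))                                ∎
    where open ℚ-Solver

-- The order ℤ[√D]

open All using (All; []; _∷_)

module Order (D : ℤ) where
  open QuadraticField D
  open ℚ-Solver using (solve; _:=_; _:+_; _:*_; :-_; _:-_; con)

  -- This structure lets the semiring solver prove identities between elements of K directly,
  -- without splitting them into coordinates.
  K-semiring : CommutativeSemiring 0ℓ 0ℓ
  K-semiring = record
    { Carrier = K ; _≈_ = _≡_ ; _+_ = _+_ ; _*_ = _*_ ; 0# = 0K ; 1# = 1K
    ; isCommutativeSemiring = record
      { isSemiring = record
        { isSemiringWithoutAnnihilatingZero = record
          { +-isCommutativeMonoid = record
            { isMonoid = record
              { isSemigroup = record
                { isMagma = record { isEquivalence = isEquivalence ; ∙-cong = cong₂ _+_ }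
                ; assoc = λ { (a +√D b) (c +√D d) (p +√D q) →
                    cong₂ _+√D_ (ℚ.+-assoc a c p) (ℚ.+-assoc b d q) }
                }
              ; identity = (λ { (a +√D b) → cong₂ _+√D_ (ℚ.+-identityˡ a) (ℚ.+-identityˡ b) })
                         , (λ { (a +√D b) → cong₂ _+√D_ (ℚ.+-identityʳ a) (ℚ.+-identityʳ b) })
              }
            ; comm = λ { (a +√D b) (c +√D d) → cong₂ _+√D_ (ℚ.+-comm a c) (ℚ.+-comm b d) }
            }
          ; *-cong = cong₂ _*_
          ; *-assoc = *-assoc
          ; *-identity = *-identityˡ , λ x → trans (*-comm x 1K) (*-identityˡ x)
          ; distrib = *-distribˡ-+ , λ x y z → trans (*-comm (y + z) x)
              (trans (*-distribˡ-+ x y z) (cong₂ _+_ (*-comm x y) (*-comm x z)))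
          }
        ; zero = *-zeroˡ , λ x → trans (*-comm x 0K) (*-zeroˡ x)
        }
      ; *-comm = *-comm
      }
    }
    where
    *-distribˡ-+ : ∀ x y z → x * (y + z) ≡ x * y + x * z
    *-distribˡ-+ (a +√D b) (c +√D d) (p +√D q) = cong₂ _+√D_
      (solve 7 (λ a b c d p q e → a :* (c :+ p) :+ e :* (b :* (d :+ q))
        := (a :* c :+ e :* (b :* d)) :+ (a :* p :+ e :* (b :* q))) refl a b c d p q (ι D))
      (solve 6 (λ a b c d p q → a :* (d :+ q) :+ b :* (c :+ p)
        := (a :* d :+ b :* c) :+ (a :* q :+ b :* p)) refl a b c d p q)
    *-zeroˡ : ∀ x → 0K * x ≡ 0K
    *-zeroˡ (a +√D b) = cong₂ _+√D_
      (solve 3 (λ a b e → con 0ℚ :* a :+ e :* (con 0ℚ :* b) := con 0ℚ) refl a b (ι D))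
      (solve 2 (λ a b → con 0ℚ :* b :+ con 0ℚ :* a := con 0ℚ) refl a b)

  open CommutativeSemiring K-semiring using (zeroʳ; *-identityʳ)
  module K-Solver = SemiringSolver K-semiring

  norm : K → ℚ
  norm (a +√D b) = a ℚ.* a ℚ.- ι D ℚ.* (b ℚ.* b)

  -- Brahmagupta's identity.
  norm-* : ∀ x y → norm (x * y) ≡ norm x ℚ.* norm y
  norm-* (a +√D b) (c +√D d) = solve 5
    (λ a b c d e →
      (a :* c :+ e :* (b :* d)) :* (a :* c :+ e :* (b :* d))
      :- e :* ((a :* d :+ b :* c) :* (a :* d :+ b :* c))
      := (a :* a :- e :* (b :* b)) :* (c :* c :- e :* (d :* d)))
    refl a b c d (ι D)

  ℤ√D : K → Set
  ℤ√D x = ∃₂ λ a b → x ≡ ι a +√D ι b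

  fromℤ∈ℤ√D : ∀ z → ℤ√D (fromℤ z)
  fromℤ∈ℤ√D z = z , 0ℤ , refl

  ℤ√D-+ : ∀ {x y} → ℤ√D x → ℤ√D y → ℤ√D (x + y)
  ℤ√D-+ (a , b , refl) (c , d , refl) = a ℤ.+ c , b ℤ.+ d , cong₂ _+√D_ (sym (ι-+ a c)) (sym (ι-+ b d))

  ι-*-+-* : ∀ a b c d → ι (a ℤ.* b ℤ.+ c ℤ.* d) ≡ ι a ℚ.* ι b ℚ.+ ι c ℚ.* ι d
  ι-*-+-* a b c d = trans (ι-+ (a ℤ.* b) (c ℤ.* d)) (cong₂ ℚ._+_ (ι-* a b) (ι-* c d))

  ι-+√D-* : ∀ a b c d → (ι a +√D ι b) * (ι c +√D ι d)
    ≡ ι (a ℤ.* c ℤ.+ D ℤ.* (b ℤ.* d)) +√D ι (a ℤ.* d ℤ.+ b ℤ.* c)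
  ι-+√D-* a b c d = cong₂ _+√D_
    (sym (trans (ι-*-+-* a c D (b ℤ.* d)) (cong (λ e → ι a ℚ.* ι c ℚ.+ ι D ℚ.* e) (ι-* b d))))
    (sym (ι-*-+-* a d b c))

  ℤ√D-* : ∀ {x y} → ℤ√D x → ℤ√D y → ℤ√D (x * y)
  ℤ√D-* (a , b , refl) (c , d , refl) =
    a ℤ.* c ℤ.+ D ℤ.* (b ℤ.* d) , a ℤ.* d ℤ.+ b ℤ.* c , ι-+√D-* a b c d

  -- Takes the place of closure under subtraction; it isolates the next tail in the Horner recursion
  -- below.
  ℤ√D-+-cancelˡ : ∀ {x y} → ℤ√D x → ℤ√D (x + y) → ℤ√D y
  ℤ√D-+-cancelˡ {y = c +√D d} (a , b , refl) (p , q , e) = p ℤ.- a , q ℤ.- b ,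
    cong₂ _+√D_ (difference a p c (cong rat e)) (difference b q d (cong irr e))
    where
    difference : ∀ a p c → ι a ℚ.+ c ≡ ι p → c ≡ ι (p ℤ.- a)
    difference a p c e = begin
      c                     ≡⟨ solve 2 (λ a c → c := a :+ c :- a) refl (ι a) c ⟩
      ι a ℚ.+ c ℚ.- ι a     ≡⟨ cong₂ ℚ._+_ e (sym (ι-neg a)) ⟩
      ι p ℚ.+ ι (ℤ.- a)     ≡⟨ ι-+ p (ℤ.- a) ⟨
      ι (p ℤ.- a)           ∎
      where open ≡-Reasoning

  normℤ : ℤ → ℤ → ℤ
  normℤ a b = a ℤ.* a ℤ.- D ℤ.* (b ℤ.* b)

  norm-ι : ∀ a b → norm (ι a +√D ι b) ≡ ι (normℤ a b)
  norm-ι a b = sym (begin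
    ι (a ℤ.* a ℤ.- D ℤ.* (b ℤ.* b))           ≡⟨ ι-+ (a ℤ.* a) _ ⟩
    ι (a ℤ.* a) ℚ.+ ι (ℤ.- (D ℤ.* (b ℤ.* b))) ≡⟨ cong₂ ℚ._+_ (ι-* a a) (ι-neg (D ℤ.* (b ℤ.* b))) ⟩
    ι a ℚ.* ι a ℚ.- ι (D ℤ.* (b ℤ.* b))
      ≡⟨ cong (λ e → ι a ℚ.* ι a ℚ.- e) (trans (ι-* D (b ℤ.* b)) (cong (ι D ℚ.*_) (ι-* b b))) ⟩
    norm (ι a +√D ι b)                        ∎)
    where open ≡-Reasoning

  -- Common denominators for the powers of an integral element

  infixr 8 _^_
  _^_ : K → ℕ → K
  x ^ zero  = 1K
  x ^ suc k = x * x ^ k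

  -- The norms of the elements d xᵏ are integers forming a geometric progression of ratio N(x). Its
  -- first term is d² ≠ 0, so `integral-ratio` applies.
  integral-norm : ∀ x d → d ≢ 0ℤ → (∀ k → ℤ√D (fromℤ d * x ^ k)) → IsInteger (norm x)
  integral-norm x d d≢0 h = integral-ratio (norm x) t t₀≢0 λ k → begin
    ι (t (suc k))                        ≡⟨ norm-t (suc k) ⟨
    norm (fromℤ d * (x * x ^ k))
      ≡⟨ cong norm (S.solve 3 (λ d x y → d S.:* (x S.:* y) S.:= x S.:* (d S.:* y)) refl (fromℤ d) x (x ^ k)) ⟩
    norm (x * (fromℤ d * x ^ k))         ≡⟨ norm-* x (fromℤ d * x ^ k) ⟩
    norm x ℚ.* norm (fromℤ d * x ^ k)    ≡⟨ cong (norm x ℚ.*_) (norm-t k) ⟩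
    norm x ℚ.* ι (t k)                   ∎
    where
    open ≡-Reasoning
    module S = K-Solver
    t : ℕ → ℤ
    t k = let a , b , _ = h k in normℤ a b
    norm-t : ∀ k → norm (fromℤ d * x ^ k) ≡ ι (t k)
    norm-t k = let a , b , e = h k in trans (cong norm e) (norm-ι a b)
    t₀≢0 : t 0 ≢ 0ℤ
    t₀≢0 t₀≡0 = d≢0 (square≡0⇒≡0 (trans (square≡normℤ d) (ι-injective (normℤ d 0ℤ) 0ℤ (begin
      ι (normℤ d 0ℤ)            ≡⟨ norm-ι d 0ℤ ⟨
      norm (fromℤ d)            ≡⟨ cong norm (*-identityʳ (fromℤ d)) ⟨
      norm (fromℤ d * 1K)       ≡⟨ norm-t 0 ⟩
      ι (t 0)                   ≡⟨ cong ι t₀≡0 ⟩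
      ι 0ℤ                      ∎))))
      where
      square≡normℤ : ∀ d → d ℤ.* d ≡ normℤ d 0ℤ
      square≡normℤ d = sym (trans (cong (λ z → d ℤ.* d ℤ.- z) (ℤ.*-zeroʳ D)) (ℤ.+-identityʳ (d ℤ.* d)))
      square≡0⇒≡0 : d ℤ.* d ≡ 0ℤ → d ≡ 0ℤ
      square≡0⇒≡0 e with ℤ.i*j≡0⇒i≡0∨j≡0 d e
      ... | inj₁ d≡0 = d≡0
      ... | inj₂ d≡0 = d≡0

  denominator : ∀ x → ∃ λ d → d ≢ 0ℤ × ℤ√D (fromℤ d * x)
  denominator x@(a +√D b) = ↧ a ℤ.* ↧ b , (λ ()) , ↥ a ℤ.* ↧ b , ↥ b ℤ.* ↧ a , cong₂ _+√D_
    (begin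
      ι (↧ a ℤ.* ↧ b) ℚ.* a ℚ.+ ι D ℚ.* (0ℚ ℚ.* b)
        ≡⟨ cong (λ d → d ℚ.* a ℚ.+ ι D ℚ.* (0ℚ ℚ.* b)) (ι-* (↧ a) (↧ b)) ⟩
      ι (↧ a) ℚ.* ι (↧ b) ℚ.* a ℚ.+ ι D ℚ.* (0ℚ ℚ.* b)
        ≡⟨ solve 5 (λ p q a b e → p :* q :* a :+ e :* (con 0ℚ :* b)
             := a :* p :* q) refl (ι (↧ a)) (ι (↧ b)) a b (ι D) ⟩
      a ℚ.* ι (↧ a) ℚ.* ι (↧ b)    ≡⟨ cong (ℚ._* ι (↧ b)) (q*↧q≡↥q a) ⟩
      ι (↥ a) ℚ.* ι (↧ b)          ≡⟨ ι-* (↥ a) (↧ b) ⟨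
      ι (↥ a ℤ.* ↧ b)              ∎)
    (begin
      ι (↧ a ℤ.* ↧ b) ℚ.* b ℚ.+ 0ℚ ℚ.* a  ≡⟨ cong (λ d → d ℚ.* b ℚ.+ 0ℚ ℚ.* a) (ι-* (↧ a) (↧ b)) ⟩
      ι (↧ a) ℚ.* ι (↧ b) ℚ.* b ℚ.+ 0ℚ ℚ.* a
        ≡⟨ solve 4 (λ p q a b → p :* q :* b :+ con 0ℚ :* a
             := b :* q :* p) refl (ι (↧ a)) (ι (↧ b)) a b ⟩
      b ℚ.* ι (↧ b) ℚ.* ι (↧ a)    ≡⟨ cong (ℚ._* ι (↧ a)) (q*↧q≡↥q b) ⟩
      ι (↥ b) ℚ.* ι (↧ a)          ≡⟨ ι-* (↥ b) (↧ a) ⟨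
      ι (↥ b ℤ.* ↧ a)              ∎)
    where open ≡-Reasoning

  fromℤ-* : ∀ y z → fromℤ (y ℤ.* z) ≡ fromℤ y * fromℤ z
  fromℤ-* y z = sym (trans (ι-+√D-* y 0ℤ z 0ℤ) (cong₂ (λ u v → ι u +√D ι v)
    (trans (cong (λ w → y ℤ.* z ℤ.+ w) (ℤ.*-zeroʳ D)) (ℤ.+-identityʳ (y ℤ.* z)))
    (cong (ℤ._+ 0ℤ) (ℤ.*-zeroʳ y))))

  common-denominator : ∀ xs → ∃ λ d → d ≢ 0ℤ × All (λ x → ℤ√D (fromℤ d * x)) xs
  common-denominator [] = 1ℤ , (λ ()) , []
  common-denominator (x ∷ xs) =
    let p , p≢0 , px = denominator x
        q , q≢0 , qxs = common-denominator xs
    in p ℤ.* q , nonzero p q p≢0 q≢0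
     , subst ℤ√D (trans
         (S.solve 3 (λ p q x → q S.:* (p S.:* x) S.:= (p S.:* q) S.:* x) refl (fromℤ p) (fromℤ q) x)
           (cong (_* x) (sym (fromℤ-* p q)))) (ℤ√D-* (fromℤ∈ℤ√D q) px)
     ∷ All.map (λ {y} qy → subst ℤ√D (trans (sym (*-assoc (fromℤ p) (fromℤ q) y))
           (cong (_* y) (sym (fromℤ-* p q)))) (ℤ√D-* (fromℤ∈ℤ√D p) qy)) qxs
    where
    module S = K-Solver
    nonzero : ∀ p q → p ≢ 0ℤ → q ≢ 0ℤ → p ℤ.* q ≢ 0ℤ
    nonzero p q p≢0 q≢0 pq≡0 with ℤ.i*j≡0⇒i≡0∨j≡0 p pq≡0
    ... | inj₁ p≡0 = p≢0 p≡0
    ... | inj₂ q≡0 = q≢0 q≡0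

  -- The tails pᵢ of the Horner scheme of a monic polynomial with root x satisfy x pᵢ₊₁ = pᵢ − cᵢ,
  -- p₀ = 0 and end in 1, so they span a lattice stable under x.
  module _ {x cs} (root : evalMonic cs x ≡ 0K) where

    private
      module S = K-Solver

      lattice : ∃ λ d → d ≢ 0ℤ × All (λ y → ℤ√D (fromℤ d * y)) (map (λ ts → evalMonic ts x) (tails cs))
      lattice = common-denominator (map (λ ts → evalMonic ts x) (tails cs))

      d : ℤ
      d = proj₁ lattice

      Clears : ℕ → List ℤ → Set
      Clears k ts = ℤ√D ((fromℤ d * x ^ k) * evalMonic ts x)

      -- The last tail is empty and evaluates to 1, so its entry says that d xᵏ itself lies in
      -- ℤ[√D].
      at-[] : ∀ {P : List ℤ → Set} ts → All P (tails ts) → P []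
      at-[] []       (p ∷ []) = p
      at-[] (_ ∷ ts) (_ ∷ ps) = at-[] ts ps

      -- Multiplying pᵢ = cᵢ + x pᵢ₊₁ by d xᵏ gives d xᵏ pᵢ = cᵢ (d xᵏ) + d xᵏ⁺¹ pᵢ₊₁. The left side
      -- and the first summand lie in ℤ[√D] at stage k, hence so does the second. Only the head at
      -- stage k + 1 has to be supplied.
      step : ∀ k ts → All (Clears k) (tails ts) → Clears (suc k) ts → All (Clears (suc k)) (tails ts)
      step k []       _        q = q ∷ []
      step k (c ∷ ts) (p ∷ ps) q = q ∷ step k ts ps
        (ℤ√D-+-cancelˡ (ℤ√D-* (fromℤ∈ℤ√D c) (at-[] ts ps))
          (subst ℤ√D (S.solve 5 (λ δ x y c e → (δ S.:* y) S.:* (c S.:+ x S.:* e)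
              S.:= c S.:* ((δ S.:* y) S.:* S.con 1) S.:+ (δ S.:* (x S.:* y)) S.:* e)
            refl (fromℤ d) x (x ^ k) (fromℤ c) (evalMonic ts x)) p))

      clears : ∀ k → All (Clears k) (tails cs)
      clears zero    = All.map (λ {ts} → subst ℤ√D (cong (_* evalMonic ts x) (sym (*-identityʳ (fromℤ d)))))
                         (map⁻ (proj₂ (proj₂ lattice)))
      -- The head is the whole polynomial; it vanishes at x, so its multiple is 0.
      clears (suc k) = step k cs (clears k)
        (subst ℤ√D (sym (trans (cong ((fromℤ d * x ^ suc k) *_) root) (zeroʳ (fromℤ d * x ^ suc k))))
          (fromℤ∈ℤ√D 0ℤ))

    almost-integral : ∃ λ d → d ≢ 0ℤ × ∀ k → ℤ√D (fromℤ d * x ^ k)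
    almost-integral = d , proj₁ (proj₂ lattice) , λ k →
      subst ℤ√D (*-identityʳ _) (at-[] cs (clears k))

  -- In place of the binomial theorem, the claim is generalised to d (1 + x)ⁱ xʲ for all j.
  -- Induction on i splits (1 + x)ⁱ⁺¹ xʲ into (1 + x)ⁱ xʲ + (1 + x)ⁱ xʲ⁺¹, and the same d serves
  -- throughout.
  almost-integral-1+ : ∀ x d → (∀ k → ℤ√D (fromℤ d * x ^ k)) → ∀ k → ℤ√D (fromℤ d * (1K + x) ^ k)
  almost-integral-1+ x d h k = subst ℤ√D (*-identityʳ _) (mixed k 0)
    where
    module S = K-Solver
    mixed : ∀ i j → ℤ√D ((fromℤ d * (1K + x) ^ i) * x ^ j)
    mixed zero    j = subst ℤ√D (cong (_* x ^ j) (sym (*-identityʳ (fromℤ d)))) (h j)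
    mixed (suc i) j = subst ℤ√D
      (S.solve 4 (λ δ x y z → (δ S.:* y) S.:* z S.:+ (δ S.:* y) S.:* (x S.:* z)
         S.:= (δ S.:* ((S.con 1 S.:+ x) S.:* y)) S.:* z)
        refl (fromℤ d) x ((1K + x) ^ i) (x ^ j))
      (ℤ√D-+ (mixed i j) (mixed i (suc j)))

-- The ring of integers and the prime above 2 when D ≡ 2 (mod 4)

2i≢2j+1 : ∀ i j → + 2 ℤ.* i ≢ + 2 ℤ.* j ℤ.+ + 1
2i≢2j+1 i j e = case (ℕ.m*n≡1⇒m≡1 2 ℤ.∣ i ℤ.- j ∣ (trans (sym (ℤ.abs-* (+ 2) (i ℤ.- j))) (cong ℤ.∣_∣ (begin
  + 2 ℤ.* (i ℤ.- j)
    ≡⟨ solve 2 (λ i j → con (+ 2) :* (i :- j) := con (+ 2) :* i :- con (+ 2) :* j) refl i j ⟩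
  + 2 ℤ.* i ℤ.- + 2 ℤ.* j                ≡⟨ cong (ℤ._- + 2 ℤ.* j) e ⟩
  + 2 ℤ.* j ℤ.+ + 1 ℤ.- + 2 ℤ.* j
    ≡⟨ solve 1 (λ j → con (+ 2) :* j :+ con (+ 1) :- con (+ 2) :* j := con (+ 1)) refl j ⟩
  + 1                                    ∎))))
  where
  open ≡-Reasoning
  open ℤ-Solver
  case : 2 ≢ 1
  case ()

even⊎odd : ∀ i → (∃ λ j → i ≡ + 2 ℤ.* j) ⊎ Odd i
even⊎odd i with i ℤ.%ℕ 2 | ℤ.n%ℕd<d i 2 | ℤ.a≡a%ℕn+[a/ℕn]*n i 2
... | 0 | _ | e = inj₁ (i ℤ./ℕ 2 , trans e
  (trans (ℤ.+-identityˡ (i ℤ./ℕ 2 ℤ.* + 2)) (ℤ.*-comm (i ℤ./ℕ 2) (+ 2))))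
... | 1 | _ | e = inj₂ (i ℤ./ℕ 2 , trans e
  (trans (ℤ.+-comm (+ 1) (i ℤ./ℕ 2 ℤ.* + 2)) (cong (ℤ._+ + 1) (ℤ.*-comm (i ℤ./ℕ 2) (+ 2)))))
... | suc (suc _) | ℕ.s≤s (ℕ.s≤s ()) | _

∣i∣≡m⇒i≡±m : ∀ i {m} → ℤ.∣ i ∣ ≡ m → i ≡ + m ⊎ i ≡ ℤ.- + m
∣i∣≡m⇒i≡±m (+ _)      refl = inj₁ refl
∣i∣≡m⇒i≡±m ℤ.-[1+ _ ] refl = inj₂ refl

halve : ∀ i j → + 2 ℤ.* i ≡ + 2 ℤ.* j → i ≡ j
halve i j = ℤ.*-cancelˡ-≡ (+ 2) i j

-- Modulo 4 the equation T² ≡ 2β² forces both to be even.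
even-solution : ∀ e ν T β → (+ 4 ℤ.* e ℤ.+ + 2) ℤ.* (β ℤ.* β) ≡ T ℤ.* T ℤ.- + 4 ℤ.* ν →
                (∃ λ s → T ≡ + 2 ℤ.* s) × (∃ λ g → β ≡ + 2 ℤ.* g)
even-solution e ν T β eq with even⊎odd T
... | inj₂ (s , refl) = ⊥-elim (2i≢2j+1
        ((+ 2 ℤ.* e ℤ.+ + 1) ℤ.* (β ℤ.* β)) (+ 2 ℤ.* (s ℤ.* s) ℤ.+ + 2 ℤ.* s ℤ.- + 2 ℤ.* ν)
        (trans (solve 2 (λ e b → con (+ 2) :* ((con (+ 2) :* e :+ con (+ 1)) :* (b :* b))
                  := (con (+ 4) :* e :+ con (+ 2)) :* (b :* b)) refl e β)
          (trans eq (solve 2 (λ s v →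
             (con (+ 2) :* s :+ con (+ 1)) :* (con (+ 2) :* s :+ con (+ 1)) :- con (+ 4) :* v
             := con (+ 2) :* (con (+ 2) :* (s :* s) :+ con (+ 2) :* s :- con (+ 2) :* v) :+ con (+ 1))
             refl s ν))))
  where open ℤ-Solver
... | inj₁ (s , refl) with even⊎odd β
...   | inj₁ β-even = (s , refl) , β-even
...   | inj₂ (g , refl) = ⊥-elim (2i≢2j+1 (s ℤ.* s ℤ.- ν)
          (e ℤ.* (γ ℤ.* γ) ℤ.+ (+ 2 ℤ.* (g ℤ.* g) ℤ.+ + 2 ℤ.* g))
          (halve _ _ (begin
            + 2 ℤ.* (+ 2 ℤ.* (s ℤ.* s ℤ.- ν))
              ≡⟨ solve 2 (λ s v → con (+ 2) :* (con (+ 2) :* (s :* s :- v))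
                  := con (+ 2) :* s :* (con (+ 2) :* s) :- con (+ 4) :* v) refl s ν ⟩
            + 2 ℤ.* s ℤ.* (+ 2 ℤ.* s) ℤ.- + 4 ℤ.* ν  ≡⟨ eq ⟨
            (+ 4 ℤ.* e ℤ.+ + 2) ℤ.* (γ ℤ.* γ)
              ≡⟨ solve 2 (λ e g → let γ = con (+ 2) :* g :+ con (+ 1) in
                (con (+ 4) :* e :+ con (+ 2)) :* (γ :* γ)
                := con (+ 2) :* (con (+ 2) :* (e :* (γ :* γ) :+ (con (+ 2) :* (g :* g) :+ con (+ 2) :* g)) :+ con (+ 1)))
                refl e g ⟩
            + 2 ℤ.* (+ 2 ℤ.* (e ℤ.* (γ ℤ.* γ) ℤ.+ (+ 2 ℤ.* (g ℤ.* g) ℤ.+ + 2 ℤ.* g)) ℤ.+ + 1) ∎)))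
  where
  open ≡-Reasoning
  open ℤ-Solver
  γ : ℤ
  γ = + 2 ℤ.* g ℤ.+ + 1

ι-halve : ∀ q z → q ℚ.+ q ≡ ι (+ 2 ℤ.* z) → q ≡ ι z
ι-halve q z e = begin
  q                       ≡⟨ solve 1 (λ q → q := con ℚ.½ :* (q :+ q)) refl q ⟩
  ℚ.½ ℚ.* (q ℚ.+ q)       ≡⟨ cong (ℚ.½ ℚ.*_) (trans e (ι-* (+ 2) z)) ⟩
  ℚ.½ ℚ.* (ι (+ 2) ℚ.* ι z) ≡⟨ solve 1 (λ z → con ℚ.½ :* (con (ι (+ 2)) :* z) := z) refl (ι z) ⟩
  ι z                     ∎
  where
  open ≡-Reasoning
  open ℚ-Solver

ι-- : ∀ y z → ι (y ℤ.- z) ≡ ι y ℚ.- ι z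
ι-- y z = trans (ι-+ y (ℤ.- z)) (cong (ι y ℚ.+_) (ι-neg z))

module TwoModFour (D e : ℤ) (D≡4e+2 : D ≡ + 4 ℤ.* e ℤ.+ + 2) (sf : Squarefree D) where
  open QuadraticField D
  open Order D

  -- For x = a + b√D the trace T = 2a is an integer, and D(2b)² = T² - 4N(x). Squarefreeness makes
  -- 2b an integer, and `even-solution` makes both 2a and 2b even.
  integral-norms⇒ℤ√D : ∀ {x} → IsInteger (norm x) → IsInteger (norm (1K + x)) → ℤ√D x
  integral-norms⇒ℤ√D {x@(a +√D b)} (ν , eν) (ν′ , eν′) =
    integers (even-solution e ν T β
      (trans (cong (ℤ._* (β ℤ.* β)) (sym D≡4e+2))
        (ι-injective (D ℤ.* (β ℤ.* β)) (T ℤ.* T ℤ.- + 4 ℤ.* ν) (begin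
          ι (D ℤ.* (β ℤ.* β))
            ≡⟨ trans (ι-* D (β ℤ.* β)) (cong (ι D ℚ.*_) (ι-* β β)) ⟩
          ι D ℚ.* (ι β ℚ.* ι β)               ≡⟨ cong (λ c → ι D ℚ.* (c ℚ.* c)) 2b≡β ⟨
          ι D ℚ.* ((b ℚ.+ b) ℚ.* (b ℚ.+ b))   ≡⟨ discriminant ⟩
          ι (T ℤ.* T ℤ.- + 4 ℤ.* ν)           ∎))))
    where
    open ≡-Reasoning
    open ℚ-Solver
    -- From N(1 + x) = 1 + Tr(x) + N(x).
    T : ℤ
    T = ν′ ℤ.- ν ℤ.- + 1
    trace : a ℚ.+ a ≡ ι T
    trace = begin
      a ℚ.+ a                               ≡⟨ solve 3 (λ a b e → a :+ a
          := ((con 1ℚ :+ a) :* (con 1ℚ :+ a) :- e :* ((con 0ℚ :+ b) :* (con 0ℚ :+ b)))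
             :- (a :* a :- e :* (b :* b)) :- con 1ℚ)
          refl a b (ι D) ⟩
      norm (1K + x) ℚ.- norm x ℚ.- 1ℚ       ≡⟨ cong₂ (λ p q → p ℚ.- q ℚ.- 1ℚ) eν′ eν ⟩
      ι ν′ ℚ.- ι ν ℚ.- 1ℚ                   ≡⟨ cong (ℚ._- 1ℚ) (ι-- ν′ ν) ⟨
      ι (ν′ ℤ.- ν) ℚ.- 1ℚ                   ≡⟨ ι-- (ν′ ℤ.- ν) (+ 1) ⟨
      ι T                                   ∎
    discriminant : ι D ℚ.* ((b ℚ.+ b) ℚ.* (b ℚ.+ b)) ≡ ι (T ℤ.* T ℤ.- + 4 ℤ.* ν)
    discriminant = begin
      ι D ℚ.* ((b ℚ.+ b) ℚ.* (b ℚ.+ b))     ≡⟨ solve 3 (λ a b e → e :* ((b :+ b) :* (b :+ b))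
          := (a :+ a) :* (a :+ a) :- con (ι (+ 4)) :* (a :* a :- e :* (b :* b))) refl a b (ι D) ⟩
      (a ℚ.+ a) ℚ.* (a ℚ.+ a) ℚ.- ι (+ 4) ℚ.* norm x
        ≡⟨ cong₂ (λ t n → t ℚ.* t ℚ.- ι (+ 4) ℚ.* n) trace eν ⟩
      ι T ℚ.* ι T ℚ.- ι (+ 4) ℚ.* ι ν       ≡⟨ cong₂ ℚ._-_ (ι-* T T) (ι-* (+ 4) ν) ⟨
      ι (T ℤ.* T) ℚ.- ι (+ 4 ℤ.* ν)         ≡⟨ ι-- (T ℤ.* T) (+ 4 ℤ.* ν) ⟨
      ι (T ℤ.* T ℤ.- + 4 ℤ.* ν)             ∎
    2b-integer : IsInteger (b ℚ.+ b)
    2b-integer = squarefree-*-square {D} sf (b ℚ.+ b) (T ℤ.* T ℤ.- + 4 ℤ.* ν , discriminant)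
    β : ℤ
    β = proj₁ 2b-integer
    2b≡β : b ℚ.+ b ≡ ι β
    2b≡β = proj₂ 2b-integer
    integers : (∃ λ s → T ≡ + 2 ℤ.* s) × (∃ λ g → β ≡ + 2 ℤ.* g) → ℤ√D x
    integers ((s , T≡2s) , (g , β≡2g)) = s , g , cong₂ _+√D_
      (ι-halve a s (trans trace (cong ι T≡2s))) (ι-halve b g (trans 2b≡β (cong ι β≡2g)))

  integral⇒ℤ√D : ∀ {x} → 𝒪 x → ℤ√D x
  integral⇒ℤ√D {x} (cs , root) =
    let d , d≢0 , powers = almost-integral {x} {cs} root
    in integral-norms⇒ℤ√D (integral-norm x d d≢0 powers)
         (integral-norm (1K + x) d d≢0 (almost-integral-1+ x d powers))

  ℤ√D⇒integral : ∀ {x} → ℤ√D x → 𝒪 x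
  -- The coefficients of X² - 2aX + (a² - Db²), of which a + b√D is a root, constant term first.
  ℤ√D⇒integral (a , b , refl) = normℤ a b ∷ ℤ.- (+ 2 ℤ.* a) ∷ [] , (begin
    fromℤ (normℤ a b) + x * (fromℤ (ℤ.- (+ 2 ℤ.* a)) + x * 1K)
      ≡⟨ cong₂ (λ n t → fromℚ n + x * (fromℚ t + x * 1K)) (sym (norm-ι a b))
           (trans (ι-neg (+ 2 ℤ.* a)) (cong ℚ.-_ (ι-* (+ 2) a))) ⟩
    fromℚ (norm x) + x * (fromℚ (ℚ.- (ι (+ 2) ℚ.* ι a)) + x * 1K)
      ≡⟨ cong₂ _+√D_
        (solve 3 (λ a b e → let t = :- (con (ι (+ 2)) :* a)
                                r = a :* con 1ℚ :+ e :* (b :* con 0ℚ)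
                                i = a :* con 0ℚ :+ b :* con 1ℚ in
           (a :* a :- e :* (b :* b)) :+ (a :* (t :+ r) :+ e :* (b :* (con 0ℚ :+ i))) := con 0ℚ)
           refl (ι a) (ι b) (ι D))
        (solve 3 (λ a b e → let t = :- (con (ι (+ 2)) :* a)
                                r = a :* con 1ℚ :+ e :* (b :* con 0ℚ)
                                i = a :* con 0ℚ :+ b :* con 1ℚ in
           con 0ℚ :+ (a :* (con 0ℚ :+ i) :+ b :* (t :+ r)) := con 0ℚ)
           refl (ι a) (ι b) (ι D)) ⟩
    0K ∎)
    where
    open ≡-Reasoning
    open ℚ-Solver
    x : K
    x = ι a +√D ι b

  -- Closure of `𝒪` is read off from ℤ[√D], with no need to build a polynomial for the sum from
  -- those of its terms.
  𝒪-+ : ∀ {x y} → 𝒪 x → 𝒪 y → 𝒪 (x + y)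
  𝒪-+ x∈ y∈ = ℤ√D⇒integral (ℤ√D-+ (integral⇒ℤ√D x∈) (integral⇒ℤ√D y∈))

  𝒪-* : ∀ {x y} → 𝒪 x → 𝒪 y → 𝒪 (x * y)
  𝒪-* x∈ y∈ = ℤ√D⇒integral (ℤ√D-* (integral⇒ℤ√D x∈) (integral⇒ℤ√D y∈))

  private
    module S = K-Solver

  -- The unit ideal and the prime above 2

  unitIdeal : NonzeroIdeal
  unitIdeal = record
    { carrier    = 𝒪
    ; integral   = λ x∈ → x∈
    ; 0-closed   = ℤ√D⇒integral (fromℤ∈ℤ√D 0ℤ)
    ; +-closed   = 𝒪-+
    ; *-closed   = 𝒪-*
    ; nonzero    = 1K , 1∈𝒪 , λ ()
    ; generators = 1K ∷ []
    ; generators-∈ = 1∈𝒪 ∷ []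
    ; generators-span = λ {x} x∈ → x , 0K , x∈ , refl ,
        S.solve 1 (λ x → x S.:= x S.:* S.con 1 S.:+ S.con 0) refl x
    }
    where
    1∈𝒪 : 𝒪 1K
    1∈𝒪 = ℤ√D⇒integral (fromℤ∈ℤ√D 1ℤ)

  √D : K
  √D = 0ℚ +√D 1ℚ

  -- The ideal (2, √D) given by its ℤ-basis 2, √D.
  P : K → Set
  P x = ∃₂ λ a b → x ≡ ι (+ 2 ℤ.* a) +√D ι b

  P⊆ℤ√D : ∀ {x} → P x → ℤ√D x
  P⊆ℤ√D (a , b , e) = + 2 ℤ.* a , b , e

  2∈P : P (fromℤ (+ 2))
  2∈P = + 1 , 0ℤ , refl

  √D∈P : P √D
  √D∈P = 0ℤ , + 1 , refl

  primeAbove2 : NonzeroIdeal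
  primeAbove2 = record
    { carrier    = P
    ; integral   = λ x∈ → ℤ√D⇒integral (P⊆ℤ√D x∈)
    ; 0-closed   = 0ℤ , 0ℤ , refl
    ; +-closed   = +-closed
    ; *-closed   = λ c∈ → *-closed (integral⇒ℤ√D c∈)
    ; nonzero    = fromℤ (+ 2) , 2∈P , λ ()
    ; generators = fromℤ (+ 2) ∷ √D ∷ []
    ; generators-∈ = 2∈P ∷ √D∈P ∷ []
    ; generators-span = span
    }
    where
    +-closed : ∀ {x y} → P x → P y → P (x + y)
    +-closed (a , b , refl) (c , d , refl) = a ℤ.+ c , b ℤ.+ d , cong₂ _+√D_
      (trans (sym (ι-+ (+ 2 ℤ.* a) (+ 2 ℤ.* c))) (cong ι (sym (ℤ.*-distribˡ-+ (+ 2) a c)))) (sym (ι-+ b d))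
    *-closed : ∀ {c x} → ℤ√D c → P x → P (c * x)
    *-closed (p , q , refl) (a , b , refl) =
      -- Half of the rational part 2pa + Dqb of the product, using D = 2(2e + 1).
      p ℤ.* a ℤ.+ (+ 2 ℤ.* e ℤ.+ + 1) ℤ.* (q ℤ.* b) ,
      p ℤ.* b ℤ.+ q ℤ.* (+ 2 ℤ.* a) ,
      trans (ι-+√D-* p q (+ 2 ℤ.* a) b) (cong (λ r → ι r +√D ι (p ℤ.* b ℤ.+ q ℤ.* (+ 2 ℤ.* a)))
        (trans (cong (λ D → p ℤ.* (+ 2 ℤ.* a) ℤ.+ D ℤ.* (q ℤ.* b)) D≡4e+2)
          (solve 5 (λ p q a b e → p :* (con (+ 2) :* a) :+ (con (+ 4) :* e :+ con (+ 2)) :* (q :* b)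
           := con (+ 2) :* (p :* a :+ (con (+ 2) :* e :+ con (+ 1)) :* (q :* b))) refl p q a b e)))
      where open ℤ-Solver
    span : ∀ {x} → P x → Span (fromℤ (+ 2) ∷ √D ∷ []) x
    span (a , b , refl) = fromℤ a , fromℤ b * √D + 0K , ℤ√D⇒integral (fromℤ∈ℤ√D a)
      , (fromℤ b , 0K , ℤ√D⇒integral (fromℤ∈ℤ√D b) , refl , refl)
      , cong₂ _+√D_
        (trans (ι-* (+ 2) a) (solve 3 (λ a b e → con (ι (+ 2)) :* a
           := (a :* con (ι (+ 2)) :+ e :* (con 0ℚ :* con 0ℚ))
              :+ ((b :* con 0ℚ :+ e :* (con 0ℚ :* con 1ℚ)) :+ con 0ℚ))
           refl (ι a) (ι b) (ι D)))
        (solve 2 (λ a b → b :=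
           (a :* con 0ℚ :+ con 0ℚ :* con (ι (+ 2)))
           :+ ((b :* con 1ℚ :+ con 0ℚ :* con 0ℚ) :+ con 0ℚ)) refl (ι a) (ι b))
      where open ℚ-Solver

  -- The norm of a generator of the prime above 2

  norm-*ℤ : ∀ a b c d p q → ι p +√D ι q ≡ (ι a +√D ι b) * (ι c +√D ι d) →
            normℤ p q ≡ normℤ a b ℤ.* normℤ c d
  norm-*ℤ a b c d p q eq = ι-injective (normℤ p q) (normℤ a b ℤ.* normℤ c d) (begin
    ι (normℤ p q)                                     ≡⟨ norm-ι p q ⟨
    norm (ι p +√D ι q)                                ≡⟨ cong norm eq ⟩
    norm ((ι a +√D ι b) * (ι c +√D ι d))              ≡⟨ norm-* (ι a +√D ι b) (ι c +√D ι d) ⟩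
    norm (ι a +√D ι b) ℚ.* norm (ι c +√D ι d)         ≡⟨ cong₂ ℚ._*_ (norm-ι a b) (norm-ι c d) ⟩
    ι (normℤ a b) ℚ.* ι (normℤ c d)                   ≡⟨ ι-* (normℤ a b) (normℤ c d) ⟨
    ι (normℤ a b ℤ.* normℤ c d)                       ∎)
    where open ≡-Reasoning

  -- As a divisor of 2, g has absolute value at most 2; an even g, that is 0 or ±2, would make the
  -- odd number gζ even. That odd number is -(2e + 1) = -D/2.
  odd-divisor-of-2 : ∀ g ν ζ → g ℤ.* ν ≡ + 2 → g ℤ.* ζ ≡ + 2 ℤ.* (ℤ.- e ℤ.- + 1) ℤ.+ + 1 → ℤ.∣ g ∣ ≡ 1
  odd-divisor-of-2 g ν ζ gν≡2 gζ-odd = go ℤ.∣ g ∣ refl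
    (ℕ.∣⇒≤ (ℕ.divides ℤ.∣ ν ∣
      (trans (sym (cong ℤ.∣_∣ gν≡2)) (trans (ℤ.abs-* g ν) (ℕ.*-comm ℤ.∣ g ∣ ℤ.∣ ν ∣)))))
    where
    even-impossible : ∀ k → g ≢ + 2 ℤ.* k
    even-impossible k refl = 2i≢2j+1 (k ℤ.* ζ) (ℤ.- e ℤ.- + 1) (trans (sym (ℤ.*-assoc (+ 2) k ζ)) gζ-odd)
    go : ∀ m → ℤ.∣ g ∣ ≡ m → m ℕ.≤ 2 → m ≡ 1
    go 0 e _ = ⊥-elim (even-impossible 0ℤ (ℤ.∣i∣≡0⇒i≡0 e))
    go 1 e _ = refl
    go 2 e _ with ∣i∣≡m⇒i≡±m g e
    ... | inj₁ g≡2 = ⊥-elim (even-impossible 1ℤ g≡2)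
    ... | inj₂ g≡-2 = ⊥-elim (even-impossible (ℤ.- 1ℤ) g≡-2)
    go (suc (suc (suc _))) _ (ℕ.s≤s (ℕ.s≤s ()))

  normℤ-even : ∀ a b → normℤ (+ 2 ℤ.* a) b ≡
               + 2 ℤ.* (+ 2 ℤ.* (a ℤ.* a) ℤ.- (+ 2 ℤ.* e ℤ.+ + 1) ℤ.* (b ℤ.* b))
  normℤ-even a b = trans (cong (λ D → + 2 ℤ.* a ℤ.* (+ 2 ℤ.* a) ℤ.- D ℤ.* (b ℤ.* b)) D≡4e+2)
    (solve 3 (λ a b e → con (+ 2) :* a :* (con (+ 2) :* a) :- (con (+ 4) :* e :+ con (+ 2)) :* (b :* b)
      := con (+ 2) :* (con (+ 2) :* (a :* a) :- (con (+ 2) :* e :+ con (+ 1)) :* (b :* b))) refl a b e)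
    where open ℤ-Solver

  normℤ-2 : normℤ (+ 2) 0ℤ ≡ + 2 ℤ.* + 2
  normℤ-2 = cong (λ z → + 4 ℤ.- z) (ℤ.*-zeroʳ D)

  normℤ-√D : normℤ 0ℤ 1ℤ ≡ + 2 ℤ.* (+ 2 ℤ.* (ℤ.- e ℤ.- + 1) ℤ.+ + 1)
  normℤ-√D = trans (cong (λ D → 0ℤ ℤ.- D ℤ.* 1ℤ) D≡4e+2)
    (solve 1 (λ e → con 0ℤ :- (con (+ 4) :* e :+ con (+ 2)) :* con 1ℤ
      := con (+ 2) :* (con (+ 2) :* (:- e :- con (+ 1)) :+ con (+ 1))) refl e)
    where open ℤ-Solver

  -- N divides N(2) = 4 and N(√D) = -2(2e + 1). Halving everything, g divides both 2 and an odd
  -- number, so it is ±1.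
  common-divisor-of-norms : ∀ N g ν ζ → N ≡ + 2 ℤ.* g →
    normℤ (+ 2) 0ℤ ≡ N ℤ.* ν → normℤ 0ℤ 1ℤ ≡ N ℤ.* ζ → ℤ.∣ N ∣ ≡ 2
  common-divisor-of-norms N g ν ζ refl eν eζ = trans (ℤ.abs-* (+ 2) g)
    (cong (2 ℕ.*_) (odd-divisor-of-2 g ν ζ
    (halve (g ℤ.* ν) (+ 2) (trans (sym (ℤ.*-assoc (+ 2) g ν)) (trans (sym eν) normℤ-2)))
    (halve (g ℤ.* ζ) (+ 2 ℤ.* (ℤ.- e ℤ.- + 1) ℤ.+ + 1)
      (trans (sym (ℤ.*-assoc (+ 2) g ζ)) (trans (sym eζ) normℤ-√D)))))

  -- Membership of c in the ideal makes its norm even, and 2 and √D being multiples of c makes its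
  -- norm divide theirs.
  generator-norm : ∀ {c} → P c → (c · ℤ√D) (fromℤ (+ 2)) → (c · ℤ√D) √D → ∃₂ λ a b → ℤ.∣ normℤ a b ∣ ≡ 2
  generator-norm (a , b , refl) (_ , (p , q , refl) , 2≡cy) (_ , (r , s , refl) , √D≡cz) = + 2 ℤ.* a , b ,
    common-divisor-of-norms (normℤ (+ 2 ℤ.* a) b) (+ 2 ℤ.* (a ℤ.* a) ℤ.- (+ 2 ℤ.* e ℤ.+ + 1) ℤ.* (b ℤ.* b))
      (normℤ p q) (normℤ r s) (normℤ-even a b)
      (norm-*ℤ (+ 2 ℤ.* a) b p q (+ 2) 0ℤ 2≡cy) (norm-*ℤ (+ 2 ℤ.* a) b r s 0ℤ 1ℤ √D≡cz)

  principal⇒norm±2 : primeAbove2 ∼ unitIdeal → ∃₂ λ a b → ℤ.∣ normℤ a b ∣ ≡ 2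
  principal⇒norm±2 (c , _ , _ , P⇔c𝒪) = generator-norm
    -- The scaling factor c is at first only an element of K; c = c · 1 places it in the ideal.
    (Equivalence.from (P⇔c𝒪 c)
      (1K , ℤ√D⇒integral (fromℤ∈ℤ√D 1ℤ) , trans (sym (*-identityˡ c)) (*-comm 1K c)))
    (weaken (Equivalence.to (P⇔c𝒪 (fromℤ (+ 2))) 2∈P))
    (weaken (Equivalence.to (P⇔c𝒪 √D) √D∈P))
    where
    weaken : ∀ {x} → (c · 𝒪) x → (c · ℤ√D) x
    weaken (y , y∈ , e) = y , integral⇒ℤ√D y∈ , e

-- From norms to the class number

+∣i∣*∣i∣≡i*i : ∀ i → + (ℤ.∣ i ∣ ℕ.* ℤ.∣ i ∣) ≡ i ℤ.* i
+∣i∣*∣i∣≡i*i (+ m)      = ℤ.pos-* m m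
+∣i∣*∣i∣≡i*i ℤ.-[1+ m ] = refl

-- The descent runs over natural numbers, so the equation is moved to absolute values; the sign of
-- the norm decides on which side the 2 stands.
norm±2 : ∀ n a b → ℤ.∣ a ℤ.* a ℤ.- (+ n ℤ.* + n ℤ.+ + 1) ℤ.* (b ℤ.* b) ∣ ≡ 2 → Norm±2 n ℤ.∣ a ∣ ℤ.∣ b ∣
norm±2 n a b e = go (∣i∣≡m⇒i≡±m (a ℤ.* a ℤ.- (+ n ℤ.* + n ℤ.+ + 1) ℤ.* (b ℤ.* b)) e)
  where
  open ≡-Reasoning
  open ℤ-Solver
  x y : ℤ
  x = a ℤ.* a
  y = (+ n ℤ.* + n ℤ.+ + 1) ℤ.* (b ℤ.* b)
  y-abs : + ((n ℕ.* n ℕ.+ 1) ℕ.* (ℤ.∣ b ∣ ℕ.* ℤ.∣ b ∣)) ≡ y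
  y-abs = trans (ℤ.pos-* (n ℕ.* n ℕ.+ 1) (ℤ.∣ b ∣ ℕ.* ℤ.∣ b ∣))
    (cong₂ ℤ._*_ (cong (ℤ._+ + 1) (ℤ.pos-* n n)) (+∣i∣*∣i∣≡i*i b))
  go : x ℤ.- y ≡ + 2 ⊎ x ℤ.- y ≡ ℤ.- + 2 → Norm±2 n ℤ.∣ a ∣ ℤ.∣ b ∣
  go (inj₁ x-y≡2) = inj₁ (ℤ.+-injective (begin
    + (ℤ.∣ a ∣ ℕ.* ℤ.∣ a ∣)       ≡⟨ +∣i∣*∣i∣≡i*i a ⟩
    x                             ≡⟨ solve 2 (λ x y → x := y :+ (x :- y)) refl x y ⟩
    y ℤ.+ (x ℤ.- y)               ≡⟨ cong₂ ℤ._+_ (sym y-abs) x-y≡2 ⟩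
    + ((n ℕ.* n ℕ.+ 1) ℕ.* (ℤ.∣ b ∣ ℕ.* ℤ.∣ b ∣) ℕ.+ 2) ∎))
  go (inj₂ x-y≡-2) = inj₂ (ℤ.+-injective (begin
    + (ℤ.∣ a ∣ ℕ.* ℤ.∣ a ∣) ℤ.+ + 2       ≡⟨ cong (ℤ._+ + 2) (+∣i∣*∣i∣≡i*i a) ⟩
    x ℤ.- (ℤ.- + 2)               ≡⟨ cong (λ z → x ℤ.- z) x-y≡-2 ⟨
    x ℤ.- (x ℤ.- y)               ≡⟨ solve 2 (λ x y → x :- (x :- y) := y) refl x y ⟩
    y                             ≡⟨ y-abs ⟨
    + ((n ℕ.* n ℕ.+ 1) ℕ.* (ℤ.∣ b ∣ ℕ.* ℤ.∣ b ∣)) ∎))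

-- By surjectivity every ideal is equivalent to the image of the single element of `Fin 1`.
one-class⇒∼ : ∀ {D} → IsClassNumber D 1 → ∀ I J → QuadraticField._∼_ D I J
one-class⇒∼ {D} bij I J = ∼-trans {I} {f zero} {J} (∼-sym {f zero} {I} (f-onto I)) (f-onto J)
  where
  open QuadraticField D
  open Bijection bij using (surjective) renaming (to to f)
  f-onto : ∀ I → f zero ∼ I
  f-onto I with surjective I
  ... | zero , onto = onto refl

open import Data.Integer.Base using (ℤ; +_; _+_; _*_; _≥_)
open import Data.Nat.Base using (ℕ; _>_)

n²+1≡4e+2 : ∀ k → (+ 2 * k + + 1) * (+ 2 * k + + 1) + + 1 ≡ + 4 * (k * k + k) + + 2
n²+1≡4e+2 = solve 1 (λ k → (con (+ 2) :* k :+ con (+ 1)) :* (con (+ 2) :* k :+ con (+ 1)) :+ con (+ 1)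
  := con (+ 4) :* (k :* k :+ k) :+ con (+ 2)) refl
  where open ℤ-Solver

class-number>1 : ∀ n e → 2 ℕ.≤ n → + n * + n + + 1 ≡ + 4 * e + + 2 → Squarefree (+ n * + n + + 1) →
                 ∀ h → IsClassNumber (+ n * + n + + 1) h → h > 1
class-number>1 n e 2≤n D≡4e+2 sf = go
  where
  open TwoModFour (+ n * + n + + 1) e D≡4e+2 sf
  go : ∀ h → IsClassNumber (+ n * + n + + 1) h → h > 1
  -- The class of the unit ideal would need a preimage in the empty `Fin 0`.
  go 0 cl with () ← proj₁ (Bijection.surjective cl unitIdeal)
  go 1 cl =
    let a , b , norm≡±2 = principal⇒norm±2 (one-class⇒∼ {+ n * + n + + 1} cl primeAbove2 unitIdeal)
    in ⊥-elim (no-Norm±2 n 2≤n ℤ.∣ b ∣ ℤ.∣ a ∣ (norm±2 n a b norm≡±2))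
  go (suc (suc _)) _ = ℕ.s≤s (ℕ.s≤s ℕ.z≤n)

corollary1p6 : (n : ℤ) → Odd n → n ≥ + 931 → Squarefree (n * n + + 1) →
    (h : ℕ) → IsClassNumber (n * n + + 1) h → h > 1
corollary1p6 (+ n) (k , n≡2k+1) (ℤ.+≤+ 931≤n) =
  -- For n = 2k + 1, n² + 1 = 4(k² + k) + 2.
  class-number>1 n (k * k + k) (ℕ.≤-trans (ℕ.s≤s (ℕ.s≤s ℕ.z≤n)) 931≤n)
    (trans (cong (λ n → n * n + + 1) n≡2k+1) (n²+1≡4e+2 k))
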